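{- Let $t(x)$ be a term in one variable in the language $\{\cdot,\to,\top\}$ and let $\mathcal{WH}$ be the variety of Wajsberg hoops. Then $t(x)$ is a conucleus on $\mathcal{WH}$ if and only if $\mathcal{WH}\vDash t(x)\approx x$.
   Context: A hoop is an algebra $\langle A,\cdot,\to,\top\rangle$ such that $\langle A,\cdot,\top\rangle$ is a commutative monoid and $x\to x=\top$, $x\cdot(x\to y)=y\cdot(y\to x)$, $x\to(y\to z)=(x\cdot y)\to z$; it is partially ordered by $x\le y$ iff $x\to y=\top$. A Wajsberg hoop is a hoop satisfying $(x\to y)\to y\approx(y\to x)\to x$. A conucleus on a hoop $\mathbf{A}$ is a map $\delta\colon A\to A$ such that for all $a,b$: $\delta(a)\le a$; $a\le b$ implies $\delta(a)\le\delta(b)$; $\delta(\delta(a))=\delta(a)$; $\delta(a)\cdot\delta(b)\le\delta(a\cdot b)$; $\delta(a)\cdot\delta(\top)=\delta(a)$. A term $t(x)$ is a conucleus on a variety $\mathcal{V}$ of hoops if $t^{\mathbf{A}}$ is a conucleus on $\mathbf{A}$ for every $\mathbf{A}\in\mathcal{V}$. -}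

module Defs where

open import Level using (Level; suc; _⊔_)
open import Algebra.Core using (Op₁; Op₂)
open import Algebra.Definitions using (Congruent₂)
open import Algebra.Structures using (IsCommutativeMonoid)
open import Relation.Binary.Core using (Rel)
open import Relation.Unary using (Pred)

record IsHoop {c ℓ} {A : Set c} (_≈_ : Rel A ℓ) (_∙_ _⇒_ : Op₂ A) (⊤ : A) : Set (c ⊔ ℓ) where
  field
    isCommutativeMonoid : IsCommutativeMonoid _≈_ _∙_ ⊤
    ⇒-cong       : Congruent₂ _≈_ _⇒_
    ⇒-refl       : ∀ x → (x ⇒ x) ≈ ⊤
    divisibility : ∀ x y → (x ∙ (x ⇒ y)) ≈ (y ∙ (y ⇒ x))
    ⇒-curry      : ∀ x y z → (x ⇒ (y ⇒ z)) ≈ ((x ∙ y) ⇒ z)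

  open IsCommutativeMonoid isCommutativeMonoid public

record Hoop c ℓ : Set (suc (c ⊔ ℓ)) where
  infixl 7 _∙_
  infixr 6 _⇒_
  infix  4 _≈_ _≤_
  field
    Carrier : Set c
    _≈_     : Rel Carrier ℓ
    _∙_     : Op₂ Carrier
    _⇒_     : Op₂ Carrier
    ⊤       : Carrier
    isHoop  : IsHoop _≈_ _∙_ _⇒_ ⊤

  open IsHoop isHoop public

  _≤_ : Rel Carrier ℓ
  x ≤ y = x ⇒ y ≈ ⊤

-- Classes of hoops are predicates on hoops; this one is the variety of Wajsberg hoops.
WH : ∀ {c ℓ} → Pred (Hoop c ℓ) (c ⊔ ℓ)
WH A = ∀ x y → (x ⇒ y) ⇒ y ≈ (y ⇒ x) ⇒ x
  where open Hoop A

-- Compatibility of δ with _≈_ is not a separate field: it follows from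
-- `monotone`, since _≤_ is a partial order with respect to _≈_.
record IsConucleus {c ℓ} (A : Hoop c ℓ) (δ : Op₁ (Hoop.Carrier A)) : Set (c ⊔ ℓ) where
  open Hoop A
  field
    contracting : ∀ a → δ a ≤ a
    monotone    : ∀ a b → a ≤ b → δ a ≤ δ b
    idempotent  : ∀ a → δ (δ a) ≈ δ a
    lax-∙       : ∀ a b → δ a ∙ δ b ≤ δ (a ∙ b)
    unital      : ∀ a → δ a ∙ δ ⊤ ≈ δ a

data Term : Set where
  var     : Term
  _·_ _⟶_ : Term → Term → Term
  ⊤′      : Term

⟦_⟧ : Term → ∀ {c ℓ} (A : Hoop c ℓ) → Op₁ (Hoop.Carrier A)
⟦ var   ⟧ A x = x
⟦ s · t ⟧ A x = Hoop._∙_ A (⟦ s ⟧ A x) (⟦ t ⟧ A x)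
⟦ s ⟶ t ⟧ A x = Hoop._⇒_ A (⟦ s ⟧ A x) (⟦ t ⟧ A x)
⟦ ⊤′    ⟧ A x = Hoop.⊤ A

_IsConucleusOn_ : ∀ {c ℓ p} → Term → Pred (Hoop c ℓ) p → Set (suc (c ⊔ ℓ) ⊔ p)
t IsConucleusOn V = ∀ A → V A → IsConucleus A (⟦ t ⟧ A)

infix 4 _⊨_≈_
_⊨_≈_ : ∀ {c ℓ p} → Pred (Hoop c ℓ) p → Term → Term → Set (suc (c ⊔ ℓ) ⊔ p)
V ⊨ s ≈ t = ∀ A → V A → ∀ x → Hoop._≈_ A (⟦ s ⟧ A x) (⟦ t ⟧ A x)

{-# OPTIONS --safe #-}

-- In a cancellative hoop t(x) is a power xᵏ with k = deg t. If t is a conucleus,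
-- idempotence and t(x) ≤ x force k = 1 (or x = ⊤), so t fixes every x that is close
-- to ⊤ on the scale of the size of t. Fixed points of a conucleus δ are closed under
-- products, because xy = δ(x)δ(y) ≤ δ(xy) ≤ xy. Hence it suffices to write a, in an
-- extension, as an n-th power with n larger than the size of t. Let S be the
-- cancellative envelope of A and put z = aⁿ in A. The MV-algebra on the interval
-- [zⁿ , ⊤] of S, where the power zⁿ is the one of S, contains the interval [z , ⊤]
-- of A through x ↦ xⁿ, and a ∈ S is the required n-th root of the image of a.
module Submission where

open import Defs
open import Level using (Level; _⊔_; Lift; lift)
open import Function.Bundles using (_⇔_; mk⇔)
open import Algebra.Bundles using (CommutativeMonoid)
import Algebra.Properties.CommutativeMonoid.Mult as Mult
open import Data.List using (List; []; _∷_; [_]; _++_)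
open import Data.List.Properties using (++-assoc; ++-identityʳ)
import Data.List.Relation.Binary.Equality.Setoid as ListEquality
open import Data.List.Relation.Binary.Pointwise using ([]; _∷_)
open import Data.Nat using (ℕ; zero; suc; _+_; _∸_)
open import Data.Product using (_×_; _,_; proj₁)
open import Data.Sum using (_⊎_; inj₁; inj₂)
import Data.Unit as Unit
open import Relation.Binary.PropositionalEquality as ≡ using (_≡_)
import Relation.Binary.Reasoning.Setoid as SetoidReasoning

-- Degree and size of a term.

-- The subtraction is truncated because in a cancellative hoop the residual of xⁿ by xᵐ is `⊤` as
-- soon as n ≤ m.
deg : Term → ℕ
deg var     = 1
deg (s · t) = deg s + deg t
deg (s ⟶ t) = deg t ∸ deg s
deg ⊤′      = 0

-- Residuals add up the occurrences as well, so that x to the power `occ t` lies below the value of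
-- every subterm of t at x.
occ : Term → ℕ
occ var     = 1
occ (s · t) = occ s + occ t
occ (s ⟶ t) = occ s + occ t
occ ⊤′      = 0

-- Arithmetic of hoops, term operations and conuclei.

module HoopProperties {c ℓ} (H : Hoop c ℓ) where
  open Hoop H

  commutativeMonoid : CommutativeMonoid c ℓ
  commutativeMonoid = record { isCommutativeMonoid = isCommutativeMonoid }

  -- The monoid is written multiplicatively here, so `n ⊛ x` is the power xⁿ.
  open Mult commutativeMonoid public
    using (×-congʳ; ×-homo-+; ×-distrib-+) renaming (_×_ to _⊛_)
  open SetoidReasoning setoid

  ⇒-congˡ : ∀ {x y z} → y ≈ z → x ⇒ y ≈ x ⇒ z
  ⇒-congˡ = ⇒-cong refl

  ⇒-congʳ : ∀ {x y z} → x ≈ y → x ⇒ z ≈ y ⇒ z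
  ⇒-congʳ x≈y = ⇒-cong x≈y refl

  ⇒-swap : ∀ x y z → x ⇒ (y ⇒ z) ≈ y ⇒ (x ⇒ z)
  ⇒-swap x y z = begin
    x ⇒ (y ⇒ z)  ≈⟨ ⇒-curry x y z ⟩
    x ∙ y ⇒ z    ≈⟨ ⇒-congʳ (comm x y) ⟩
    y ∙ x ⇒ z    ≈⟨ ⇒-curry y x z ⟨
    y ⇒ (x ⇒ z)  ∎

  ≤-reflexive : ∀ {x y} → x ≈ y → x ≤ y
  ≤-reflexive {x} {y} x≈y = trans (⇒-congʳ x≈y) (⇒-refl y)

  ≤-antisym : ∀ {x y} → x ≤ y → y ≤ x → x ≈ y
  ≤-antisym {x} {y} x≤y y≤x = begin
    x            ≈⟨ identityʳ x ⟨
    x ∙ ⊤        ≈⟨ ∙-congˡ x≤y ⟨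
    x ∙ (x ⇒ y)  ≈⟨ divisibility x y ⟩
    y ∙ (y ⇒ x)  ≈⟨ ∙-congˡ y≤x ⟩
    y ∙ ⊤        ≈⟨ identityʳ y ⟩
    y            ∎

  ⇒-identityˡ : ∀ x → ⊤ ⇒ x ≈ x
  ⇒-identityˡ x = ≤-antisym
    (begin
      (⊤ ⇒ x) ⇒ x        ≈⟨ ⇒-congʳ (identityʳ (⊤ ⇒ x)) ⟨
      (⊤ ⇒ x) ∙ ⊤ ⇒ x    ≈⟨ ⇒-curry (⊤ ⇒ x) ⊤ x ⟨
      (⊤ ⇒ x) ⇒ (⊤ ⇒ x)  ≈⟨ ⇒-refl (⊤ ⇒ x) ⟩
      ⊤                  ∎)
    (begin
      x ⇒ (⊤ ⇒ x)        ≈⟨ ⇒-curry x ⊤ x ⟩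
      x ∙ ⊤ ⇒ x          ≈⟨ ≤-reflexive (identityʳ x) ⟩
      ⊤                  ∎)

  -- Divisibility applied to `⊤` and `x` rewrites `x` as `x ∙ (x ⇒ ⊤)`; currying then produces a
  -- residual of `x ⇒ ⊤` by itself.
  ⇒-zeroʳ : ∀ x → x ⇒ ⊤ ≈ ⊤
  ⇒-zeroʳ x = begin
    x ⇒ ⊤              ≈⟨ ⇒-congʳ (⇒-identityˡ x) ⟨
    (⊤ ⇒ x) ⇒ ⊤        ≈⟨ ⇒-congʳ (identityˡ (⊤ ⇒ x)) ⟨
    ⊤ ∙ (⊤ ⇒ x) ⇒ ⊤    ≈⟨ ⇒-congʳ (divisibility ⊤ x) ⟩
    x ∙ (x ⇒ ⊤) ⇒ ⊤    ≈⟨ ⇒-curry x (x ⇒ ⊤) ⊤ ⟨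
    x ⇒ ((x ⇒ ⊤) ⇒ ⊤)  ≈⟨ ⇒-swap x (x ⇒ ⊤) ⊤ ⟩
    (x ⇒ ⊤) ⇒ (x ⇒ ⊤)  ≈⟨ ⇒-refl (x ⇒ ⊤) ⟩
    ⊤                  ∎

  ≤-trans : ∀ {x y z} → x ≤ y → y ≤ z → x ≤ z
  ≤-trans {x} {y} {z} x≤y y≤z = begin
    x ⇒ z              ≈⟨ ⇒-congʳ (identityʳ x) ⟨
    x ∙ ⊤ ⇒ z          ≈⟨ ⇒-congʳ (∙-congˡ x≤y) ⟨
    x ∙ (x ⇒ y) ⇒ z    ≈⟨ ⇒-congʳ (divisibility x y) ⟩
    y ∙ (y ⇒ x) ⇒ z    ≈⟨ ⇒-curry y (y ⇒ x) z ⟨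
    y ⇒ ((y ⇒ x) ⇒ z)  ≈⟨ ⇒-swap y (y ⇒ x) z ⟩
    (y ⇒ x) ⇒ (y ⇒ z)  ≈⟨ ⇒-congˡ y≤z ⟩
    (y ⇒ x) ⇒ ⊤        ≈⟨ ⇒-zeroʳ (y ⇒ x) ⟩
    ⊤                  ∎

  ⊤≤x⇒x≈⊤ : ∀ {x} → ⊤ ≤ x → x ≈ ⊤
  ⊤≤x⇒x≈⊤ {x} ⊤≤x = trans (sym (⇒-identityˡ x)) ⊤≤x

  x∙y≤y : ∀ x y → x ∙ y ≤ y
  x∙y≤y x y = begin
    x ∙ y ⇒ y    ≈⟨ ⇒-curry x y y ⟨
    x ⇒ (y ⇒ y)  ≈⟨ ⇒-congˡ (⇒-refl y) ⟩
    x ⇒ ⊤        ≈⟨ ⇒-zeroʳ x ⟩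
    ⊤            ∎

  x∙y≤x : ∀ x y → x ∙ y ≤ x
  x∙y≤x x y = trans (⇒-congʳ (comm x y)) (x∙y≤y y x)

  y≤x⇒y : ∀ x y → y ≤ (x ⇒ y)
  y≤x⇒y x y = trans (⇒-curry y x y) (x∙y≤x y x)

  x∙y≈⊤⇒x≈⊤ : ∀ {x y} → x ∙ y ≈ ⊤ → x ≈ ⊤
  x∙y≈⊤⇒x≈⊤ {x} {y} xy≈⊤ = ⊤≤x⇒x≈⊤ (trans (⇒-congʳ (sym xy≈⊤)) (x∙y≤x x y))

  ∙-mono : ∀ {x y z w} → x ≤ y → z ≤ w → x ∙ z ≤ y ∙ w
  ∙-mono {x} {y} {z} {w} x≤y z≤w = trans (sym (⇒-curry x z (y ∙ w)))
    (≤-trans x≤y (trans (⇒-swap y z (y ∙ w))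
      (≤-trans z≤w (trans (⇒-curry w y (y ∙ w)) (≤-reflexive (comm w y))))))

  x≤¬¬x : ∀ x u → x ≤ ((x ⇒ u) ⇒ u)
  x≤¬¬x x u = trans (⇒-swap x (x ⇒ u) u) (⇒-refl (x ⇒ u))

  ⇒-antimonoˡ : ∀ {x y} u → x ≤ y → (y ⇒ u) ≤ (x ⇒ u)
  ⇒-antimonoˡ {x} {y} u x≤y =
    trans (⇒-swap (y ⇒ u) x u) (≤-trans x≤y (x≤¬¬x y u))

  -- The map `_⇒ u` forms an antitone Galois connection with itself.
  ¬¬¬-elim : ∀ x u → ((x ⇒ u) ⇒ u) ⇒ u ≈ x ⇒ u
  ¬¬¬-elim x u = ≤-antisym (⇒-antimonoˡ u (x≤¬¬x x u)) (x≤¬¬x (x ⇒ u) u)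

  ⊛-mono : ∀ n {x y} → x ≤ y → n ⊛ x ≤ n ⊛ y
  ⊛-mono zero    x≤y = ⇒-refl ⊤
  ⊛-mono (suc n) x≤y = ∙-mono x≤y (⊛-mono n x≤y)

  ⊛-⊤ : ∀ n → n ⊛ ⊤ ≈ ⊤
  ⊛-⊤ zero    = refl
  ⊛-⊤ (suc n) = trans (identityˡ (n ⊛ ⊤)) (⊛-⊤ n)

  ⟦⟧-cong : ∀ t {x y} → x ≈ y → ⟦ t ⟧ H x ≈ ⟦ t ⟧ H y
  ⟦⟧-cong var     x≈y = x≈y
  ⟦⟧-cong (s · t) x≈y = ∙-cong (⟦⟧-cong s x≈y) (⟦⟧-cong t x≈y)
  ⟦⟧-cong (s ⟶ t) x≈y = ⇒-cong (⟦⟧-cong s x≈y) (⟦⟧-cong t x≈y)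
  ⟦⟧-cong ⊤′      x≈y = refl

  ⟦⟧-⊤ : ∀ t → ⟦ t ⟧ H ⊤ ≈ ⊤
  ⟦⟧-⊤ var     = refl
  ⟦⟧-⊤ (s · t) = trans (∙-cong (⟦⟧-⊤ s) (⟦⟧-⊤ t)) (identityˡ ⊤)
  ⟦⟧-⊤ (s ⟶ t) = trans (⇒-cong (⟦⟧-⊤ s) (⟦⟧-⊤ t)) (⇒-refl ⊤)
  ⟦⟧-⊤ ⊤′      = refl

  occ-≤ : ∀ t x → occ t ⊛ x ≤ ⟦ t ⟧ H x
  occ-≤ var     x = ≤-reflexive (identityʳ x)
  occ-≤ (s · t) x =
    ≤-trans (≤-reflexive (×-homo-+ x (occ s) (occ t))) (∙-mono (occ-≤ s x) (occ-≤ t x))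
  occ-≤ (s ⟶ t) x =
    ≤-trans (≤-reflexive (×-homo-+ x (occ s) (occ t)))
      (≤-trans (x∙y≤y (occ s ⊛ x) (occ t ⊛ x))
        (≤-trans (occ-≤ t x) (y≤x⇒y (⟦ s ⟧ H x) (⟦ t ⟧ H x))))
  occ-≤ ⊤′      x = ⇒-refl ⊤

  conucleus-fixes-∙ : ∀ {δ} → IsConucleus H δ →
    ∀ {x y} → δ x ≈ x → δ y ≈ y → δ (x ∙ y) ≈ x ∙ y
  conucleus-fixes-∙ con {x} {y} δx≈x δy≈y = ≤-antisym (contracting (x ∙ y))
    (≤-trans (≤-reflexive (sym (∙-cong δx≈x δy≈y))) (lax-∙ x y))
    where open IsConucleus con

  ⟦⟧-fixes-⊛ : ∀ t → IsConucleus H (⟦ t ⟧ H) →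
    ∀ {x} → ⟦ t ⟧ H x ≈ x → ∀ n → ⟦ t ⟧ H (n ⊛ x) ≈ n ⊛ x
  -- A conucleus in general may move `⊤`, but a term operation cannot.
  ⟦⟧-fixes-⊛ t con tx≈x zero    = ⟦⟧-⊤ t
  ⟦⟧-fixes-⊛ t con tx≈x (suc n) = conucleus-fixes-∙ con tx≈x (⟦⟧-fixes-⊛ t con tx≈x n)

  id-isConucleus : ∀ {δ} → (∀ x → δ x ≈ x) → IsConucleus H δ
  id-isConucleus {δ} δ≈id = record
    { contracting = λ a → ≤-reflexive (δ≈id a)
    ; monotone    = λ a b a≤b → trans (⇒-cong (δ≈id a) (δ≈id b)) a≤b
    ; idempotent  = λ a → δ≈id (δ a)
    ; lax-∙       = λ a b →
        ≤-reflexive (trans (∙-cong (δ≈id a) (δ≈id b)) (sym (δ≈id (a ∙ b))))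
    ; unital      = λ a → trans (∙-congˡ (δ≈id ⊤)) (identityʳ (δ a))
    }

-- Intervals of Wajsberg hoops as MV-algebras.

-- The MV-algebra on the interval from u to ⊤. Rather than restricting the
-- carrier, every x is identified with (x ⇒ u) ⇒ u.
module Interval {c ℓ} (H : Hoop c ℓ) (wajsberg : WH H) (u : Hoop.Carrier H) where
  open Hoop H
  open HoopProperties H
  open SetoidReasoning setoid

  infix  8 ¬_
  infixr 6 _⇒ᵤ_
  infix  4 _≈ᵤ_

  ¬_ : Carrier → Carrier
  ¬ x = x ⇒ u

  -- By `¬¬¬-elim`, comparing negations is the same as comparing double negations, which are the
  -- representatives in the interval.
  _≈ᵤ_ : Carrier → Carrier → Set ℓ
  x ≈ᵤ y = ¬ x ≈ ¬ y

  -- The implication of an MV-algebra in terms of product and negation. It equals `x ⇒ ¬ ¬ y`, the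
  -- residual into the representative of `y`.
  _⇒ᵤ_ : Carrier → Carrier → Carrier
  x ⇒ᵤ y = ¬ (x ∙ ¬ y)

  ¬-cong : ∀ {x y} → x ≈ y → ¬ x ≈ ¬ y
  ¬-cong = ⇒-congʳ

  ¬-∙ : ∀ x y → ¬ (x ∙ y) ≈ x ⇒ ¬ y
  ¬-∙ x y = sym (⇒-curry x y u)

  -- Written as the residual `x ⇒ ¬ z`, the negated product depends on `z` only through `¬ z`;
  -- exchanging the factors gives the same for `x`.
  ∙-congᵤ : ∀ x y z w → x ≈ᵤ y → z ≈ᵤ w → x ∙ z ≈ᵤ y ∙ w
  ∙-congᵤ x y z w x≈y z≈w = begin
    ¬ (x ∙ z)  ≈⟨ ¬-∙ x z ⟩
    x ⇒ ¬ z    ≈⟨ ⇒-congˡ z≈w ⟩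
    x ⇒ ¬ w    ≈⟨ ⇒-swap x w u ⟩
    w ⇒ ¬ x    ≈⟨ ⇒-congˡ x≈y ⟩
    w ⇒ ¬ y    ≈⟨ ⇒-swap w y u ⟩
    y ⇒ ¬ w    ≈⟨ ¬-∙ y w ⟨
    ¬ (y ∙ w)  ∎

  ⇒¬-¬¬ˡ : ∀ x y → x ⇒ ¬ y ≈ ¬ ¬ x ⇒ ¬ y
  ⇒¬-¬¬ˡ x y = begin
    x ⇒ ¬ y        ≈⟨ ⇒-swap x y u ⟩
    y ⇒ ¬ x        ≈⟨ ⇒-congˡ (¬¬¬-elim x u) ⟨
    y ⇒ ¬ ¬ ¬ x    ≈⟨ ⇒-swap y (¬ ¬ x) u ⟩
    ¬ ¬ x ⇒ ¬ y    ∎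

  -- De Morgan: the negated meet is the join of the negations, so divisibility in the interval
  -- reduces to the Wajsberg identity in `H`.
  ⇒ᵤ-meet : ∀ x y → ¬ (x ∙ (x ⇒ᵤ y)) ≈ (¬ y ⇒ ¬ x) ⇒ ¬ x
  ⇒ᵤ-meet x y = begin
    ¬ (x ∙ (x ⇒ᵤ y))       ≈⟨ ¬-cong (comm x (x ⇒ᵤ y)) ⟩
    ¬ ((x ⇒ᵤ y) ∙ x)       ≈⟨ ¬-∙ (x ⇒ᵤ y) x ⟩
    (x ⇒ᵤ y) ⇒ ¬ x         ≈⟨ ⇒-congʳ (trans (¬-∙ x (¬ y)) (⇒-swap x (¬ y) u)) ⟩
    (¬ y ⇒ ¬ x) ⇒ ¬ x      ∎

  ⇒ᵤ-join : ∀ x y → (x ⇒ᵤ y) ⇒ᵤ y ≈ (¬ ¬ x ⇒ ¬ ¬ y) ⇒ ¬ ¬ y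
  ⇒ᵤ-join x y = begin
    ¬ ((x ⇒ᵤ y) ∙ ¬ y)         ≈⟨ ¬-∙ (x ⇒ᵤ y) (¬ y) ⟩
    (x ⇒ᵤ y) ⇒ ¬ ¬ y           ≈⟨ ⇒-congʳ (¬-∙ x (¬ y)) ⟩
    (x ⇒ ¬ ¬ y) ⇒ ¬ ¬ y        ≈⟨ ⇒-congʳ (⇒¬-¬¬ˡ x (¬ y)) ⟩
    (¬ ¬ x ⇒ ¬ ¬ y) ⇒ ¬ ¬ y    ∎

  interval : Hoop c ℓ
  interval = record
    { Carrier = Carrier
    ; _≈_     = _≈ᵤ_
    ; _∙_     = _∙_
    ; _⇒_     = _⇒ᵤ_
    ; ⊤       = ⊤
    ; isHoop  = record
      { isCommutativeMonoid = record
        { isMonoid = record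
          { isSemigroup = record
            { isMagma = record
              { isEquivalence = record { refl = refl ; sym = sym ; trans = trans }
              ; ∙-cong        = λ {x} {y} {z} {w} → ∙-congᵤ x y z w
              }
            ; assoc = λ x y z → ¬-cong (assoc x y z)
            }
          ; identity = (λ x → ¬-cong (identityˡ x)) , (λ x → ¬-cong (identityʳ x))
          }
        ; comm = λ x y → ¬-cong (comm x y)
        }
      ; ⇒-cong       = λ {x} {y} {z} {w} x≈y z≈w →
          ¬-cong (∙-congᵤ x y (¬ z) (¬ w) x≈y (¬-cong z≈w))
      ; ⇒-refl       = λ x → ¬-cong
          (trans (¬-∙ x (¬ x)) (x≤¬¬x x u))
      ; divisibility = λ x y → begin
          ¬ (x ∙ (x ⇒ᵤ y))   ≈⟨ ⇒ᵤ-meet x y ⟩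
          (¬ y ⇒ ¬ x) ⇒ ¬ x  ≈⟨ wajsberg (¬ y) (¬ x) ⟩
          (¬ x ⇒ ¬ y) ⇒ ¬ y  ≈⟨ ⇒ᵤ-meet y x ⟨
          ¬ (y ∙ (y ⇒ᵤ x))   ∎
      ; ⇒-curry      = λ x y z → ¬-cong (begin
          ¬ (x ∙ ¬ ¬ (y ∙ ¬ z))  ≈⟨ ¬-∙ x (¬ ¬ (y ∙ ¬ z)) ⟩
          x ⇒ ¬ ¬ ¬ (y ∙ ¬ z)    ≈⟨ ⇒-congˡ (¬¬¬-elim (y ∙ ¬ z) u) ⟩
          x ⇒ ¬ (y ∙ ¬ z)        ≈⟨ ¬-∙ x (y ∙ ¬ z) ⟨
          ¬ (x ∙ (y ∙ ¬ z))      ≈⟨ ¬-cong (assoc x y (¬ z)) ⟨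
          ¬ ((x ∙ y) ∙ ¬ z)      ∎)
      }
    }

  interval-wajsberg : WH interval
  interval-wajsberg x y = ¬-cong (begin
    (x ⇒ᵤ y) ⇒ᵤ y            ≈⟨ ⇒ᵤ-join x y ⟩
    (¬ ¬ x ⇒ ¬ ¬ y) ⇒ ¬ ¬ y  ≈⟨ wajsberg (¬ ¬ x) (¬ ¬ y) ⟩
    (¬ ¬ y ⇒ ¬ ¬ x) ⇒ ¬ ¬ x  ≈⟨ ⇒ᵤ-join y x ⟨
    (y ⇒ᵤ x) ⇒ᵤ x            ∎)

  ⊛-interval : ∀ n x → HoopProperties._⊛_ interval n x ≡ n ⊛ x
  ⊛-interval zero    x = ≡.refl
  ⊛-interval (suc n) x = ≡.cong (x ∙_) (⊛-interval n x)

  ¬¬-fixed : ∀ {x} → u ≤ x → ¬ ¬ x ≈ x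
  ¬¬-fixed {x} u≤x = begin
    ¬ ¬ x        ≈⟨ wajsberg x u ⟩
    (u ⇒ x) ⇒ x  ≈⟨ ⇒-congʳ u≤x ⟩
    ⊤ ⇒ x        ≈⟨ ⇒-identityˡ x ⟩
    x            ∎

  ≈ᵤ⇒≈ : ∀ {x y} → u ≤ x → u ≤ y → x ≈ᵤ y → x ≈ y
  ≈ᵤ⇒≈ u≤x u≤y x≈y = trans (sym (¬¬-fixed u≤x)) (trans (¬-cong x≈y) (¬¬-fixed u≤y))

  -- The bound passes to subterms and, with `occ-≤`, puts their values above `u`. There `¬ ¬` is the
  -- identity, so `⇒ᵤ` agrees with `⇒`.
  ⟦⟧-interval : ∀ t x → u ≤ occ t ⊛ x → ⟦ t ⟧ interval x ≈ᵤ ⟦ t ⟧ H x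
  ⟦⟧-interval var     x u≤ = refl
  ⟦⟧-interval (s · t) x u≤ =
    ∙-congᵤ _ (⟦ s ⟧ H x) _ (⟦ t ⟧ H x)
            (⟦⟧-interval s x (≤-trans u≤st (x∙y≤x (occ s ⊛ x) (occ t ⊛ x))))
            (⟦⟧-interval t x (≤-trans u≤st (x∙y≤y (occ s ⊛ x) (occ t ⊛ x))))
    where u≤st = ≤-trans u≤ (≤-reflexive (×-homo-+ x (occ s) (occ t)))
  ⟦⟧-interval (s ⟶ t) x u≤ = ¬-cong (begin
    ¬ (⟦ s ⟧ interval x ∙ ¬ ⟦ t ⟧ interval x)
      ≈⟨ ∙-congᵤ _ (⟦ s ⟧ H x) _ (¬ ⟦ t ⟧ H x)
           (⟦⟧-interval s x u≤s) (¬-cong (⟦⟧-interval t x u≤t)) ⟩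
    ¬ (⟦ s ⟧ H x ∙ ¬ ⟦ t ⟧ H x)  ≈⟨ ¬-∙ (⟦ s ⟧ H x) (¬ ⟦ t ⟧ H x) ⟩
    ⟦ s ⟧ H x ⇒ ¬ ¬ ⟦ t ⟧ H x    ≈⟨ ⇒-congˡ (¬¬-fixed (≤-trans u≤t (occ-≤ t x))) ⟩
    ⟦ s ⟧ H x ⇒ ⟦ t ⟧ H x        ∎)
    where
    u≤st = ≤-trans u≤ (≤-reflexive (×-homo-+ x (occ s) (occ t)))
    u≤s  = ≤-trans u≤st (x∙y≤x (occ s ⊛ x) (occ t ⊛ x))
    u≤t  = ≤-trans u≤st (x∙y≤y (occ s ⊛ x) (occ t ⊛ x))
  ⟦⟧-interval ⊤′      x u≤ = refl

-- Cancellative hoops: powers, residuals and term operations.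

-- By currying this is equivalent to the familiar law x → x z = z.
Cancellative : ∀ {c ℓ} → Hoop c ℓ → Set (c ⊔ ℓ)
Cancellative H = ∀ x y z → x ∙ y ⇒ x ∙ z ≈ y ⇒ z
  where open Hoop H

module CancellativeProperties {c ℓ} (H : Hoop c ℓ) (cancel : Cancellative H) where
  open Hoop H
  open HoopProperties H
  open SetoidReasoning setoid

  -- Multiplied through by `x`, the left side becomes the residual of the product of `x` and `y` by
  -- their meet, which is symmetric.
  cancellative⇒wajsberg : WH H
  cancellative⇒wajsberg x y = begin
    (x ⇒ y) ⇒ y              ≈⟨ cancel x (x ⇒ y) y ⟨
    x ∙ (x ⇒ y) ⇒ x ∙ y      ≈⟨ ⇒-cong (divisibility x y) (comm x y) ⟩
    y ∙ (y ⇒ x) ⇒ y ∙ x      ≈⟨ cancel y (y ⇒ x) x ⟩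
    (y ⇒ x) ⇒ x              ∎

  x∙y≈x⇒y≈⊤ : ∀ {x y} → x ∙ y ≈ x → y ≈ ⊤
  x∙y≈x⇒y≈⊤ {x} {y} xy≈x = ⊤≤x⇒x≈⊤ (begin
    ⊤ ⇒ y          ≈⟨ cancel x ⊤ y ⟨
    x ∙ ⊤ ⇒ x ∙ y  ≈⟨ ⇒-cong (identityʳ x) xy≈x ⟩
    x ⇒ x          ≈⟨ ⇒-refl x ⟩
    ⊤              ∎)

  ⊛-∸ : ∀ x m n → m ⊛ x ⇒ n ⊛ x ≈ (n ∸ m) ⊛ x
  ⊛-∸ x zero    n       = ⇒-identityˡ (n ⊛ x)
  ⊛-∸ x (suc m) zero    = ⇒-zeroʳ (suc m ⊛ x)
  ⊛-∸ x (suc m) (suc n) = trans (cancel x (m ⊛ x) (n ⊛ x)) (⊛-∸ x m n)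

  ⟦⟧≈deg⊛ : ∀ t x → ⟦ t ⟧ H x ≈ deg t ⊛ x
  ⟦⟧≈deg⊛ var     x = sym (identityʳ x)
  ⟦⟧≈deg⊛ (s · t) x =
    trans (∙-cong (⟦⟧≈deg⊛ s x) (⟦⟧≈deg⊛ t x)) (sym (×-homo-+ x (deg s) (deg t)))
  ⟦⟧≈deg⊛ (s ⟶ t) x =
    trans (⇒-cong (⟦⟧≈deg⊛ s x) (⟦⟧≈deg⊛ t x)) (⊛-∸ x (deg s) (deg t))
  ⟦⟧≈deg⊛ ⊤′      x = refl

  ⇒-fixed-⊛ : ∀ {x y} → x ⇒ y ≈ y → ∀ n → n ⊛ x ⇒ y ≈ y
  ⇒-fixed-⊛ {x} {y} xy≈y zero    = ⇒-identityˡ y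
  ⇒-fixed-⊛ {x} {y} xy≈y (suc n) = begin
    x ∙ n ⊛ x ⇒ y    ≈⟨ ⇒-curry x (n ⊛ x) y ⟨
    x ⇒ (n ⊛ x ⇒ y)  ≈⟨ ⇒-congˡ (⇒-fixed-⊛ xy≈y n) ⟩
    x ⇒ y            ≈⟨ xy≈y ⟩
    y                ∎

  -- x ⇒ y ≈ y says that the join (x ⇒ y) ⇒ y of x and y is ⊤, which is symmetric.
  ⇒-fixed-sym : ∀ {x y} → x ⇒ y ≈ y → y ⇒ x ≈ x
  ⇒-fixed-sym {x} {y} xy≈y = ≤-antisym
    (begin
      (y ⇒ x) ⇒ x  ≈⟨ cancellative⇒wajsberg y x ⟩
      (x ⇒ y) ⇒ y  ≈⟨ ≤-reflexive xy≈y ⟩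
      ⊤            ∎)
    (y≤x⇒y y x)

  -- Insert the factor `x` on both sides, rewrite the meet by divisibility, and cancel `y ⇒ x`. The
  -- outcome says that `x ⇒ y` and `y ⇒ x` have join `⊤`.
  ⇒-prelinear : ∀ x y → (y ⇒ x) ⇒ (x ⇒ y) ≈ x ⇒ y
  ⇒-prelinear x y = begin
    (y ⇒ x) ⇒ (x ⇒ y)          ≈⟨ cancel x (y ⇒ x) (x ⇒ y) ⟨
    x ∙ (y ⇒ x) ⇒ x ∙ (x ⇒ y)  ≈⟨ ⇒-cong (comm x (y ⇒ x))
                                            (trans (divisibility x y) (comm y (y ⇒ x))) ⟩
    (y ⇒ x) ∙ x ⇒ (y ⇒ x) ∙ y  ≈⟨ cancel (y ⇒ x) x y ⟩
    x ⇒ y                      ∎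

  -- With p and q the two residuals, x p = y q is the meet, hence xⁿ pⁿ = yⁿ qⁿ. Cancellation
  -- reduces the claim to qⁿ ⇒ pⁿ = pⁿ, that is, to pⁿ and qⁿ having join `⊤`.
  ⊛-⇒ : ∀ n x y → n ⊛ x ⇒ n ⊛ y ≈ n ⊛ (x ⇒ y)
  ⊛-⇒ n x y = begin
    n ⊛ x ⇒ n ⊛ y                      ≈⟨ cancel (n ⊛ q) (n ⊛ x) (n ⊛ y) ⟨
    n ⊛ q ∙ n ⊛ x ⇒ n ⊛ q ∙ n ⊛ y      ≈⟨ ⇒-cong (comm (n ⊛ q) (n ⊛ x)) (comm (n ⊛ q) (n ⊛ y)) ⟩
    n ⊛ x ∙ n ⊛ q ⇒ n ⊛ y ∙ n ⊛ q      ≈⟨ ⇒-congˡ yq≈xp ⟩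
    n ⊛ x ∙ n ⊛ q ⇒ n ⊛ x ∙ n ⊛ p      ≈⟨ cancel (n ⊛ x) (n ⊛ q) (n ⊛ p) ⟩
    n ⊛ q ⇒ n ⊛ p                      ≈⟨ nq⇒np≈np ⟩
    n ⊛ p                              ∎
    where
    p = x ⇒ y
    q = y ⇒ x
    nq⇒np≈np : n ⊛ q ⇒ n ⊛ p ≈ n ⊛ p
    -- Only the left argument can be raised to a power directly, so symmetry is used to treat q
    -- first and then p.
    nq⇒np≈np = ⇒-fixed-sym (⇒-fixed-⊛ (⇒-fixed-sym (⇒-fixed-⊛ (⇒-prelinear x y) n)) n)
    yq≈xp : n ⊛ y ∙ n ⊛ q ≈ n ⊛ x ∙ n ⊛ p
    yq≈xp = begin
      n ⊛ y ∙ n ⊛ q  ≈⟨ ×-distrib-+ y q n ⟨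
      n ⊛ (y ∙ q)    ≈⟨ ×-congʳ n (divisibility y x) ⟩
      n ⊛ (x ∙ p)    ≈⟨ ×-distrib-+ x p n ⟩
      n ⊛ x ∙ n ⊛ p  ∎

  -- The alternative is taken at each `x`, which avoids deciding whether the hoop is trivial.
  conucleus-deg : ∀ t → IsConucleus H (⟦ t ⟧ H) → ∀ x → deg t ≡ 1 ⊎ x ≈ ⊤
  conucleus-deg t con x with deg t | ⟦⟧≈deg⊛ t
  ... | 0           | t≈ = inj₂
    (⊤≤x⇒x≈⊤ (trans (⇒-congʳ (sym (t≈ x))) (IsConucleus.contracting con x)))
  ... | 1           | t≈ = inj₁ ≡.refl
  -- For y = xᵏ⁺², idempotence reads yᵏ⁺² = y. Cancelling y gives yᵏ⁺¹ = `⊤`, and all factors of `⊤`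
  -- are `⊤`.
  ... | suc (suc k) | t≈ = inj₂ (x∙y≈⊤⇒x≈⊤ (x∙y≈⊤⇒x≈⊤ (x∙y≈x⇒y≈⊤ (begin
    suc (suc k) ⊛ (suc (suc k) ⊛ x)  ≈⟨ t≈ (suc (suc k) ⊛ x) ⟨
    ⟦ t ⟧ H (suc (suc k) ⊛ x)        ≈⟨ ⟦⟧-cong t (t≈ x) ⟨
    ⟦ t ⟧ H (⟦ t ⟧ H x)              ≈⟨ IsConucleus.idempotent con x ⟩
    ⟦ t ⟧ H x                        ≈⟨ t≈ x ⟩
    suc (suc k) ⊛ x                  ∎))))

-- The cancellative envelope of a Wajsberg hoop.

-- Bosbach's cancellative envelope: the list x₁ ∷ … ∷ xₙ ∷ [] stands for the product
-- of its entries in the negative cone of a lattice-ordered group having A as an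
-- initial segment. There a residual by a product is an iterated residual, and
-- x ⇒ y z = (x ⇒ y) ((y ⇒ x) ⇒ z).
module Envelope {c ℓ} (A : Hoop c ℓ) (wajsberg : WH A) where
  open Hoop A
  open HoopProperties A
  open ListEquality setoid
    using (_≋_; ≋-refl; ≋-sym; ≋-trans; ≋-reflexive; ≋-setoid)
  open SetoidReasoning ≋-setoid

  infixr 6 _▷_ _⇛_
  infix  4 _≲_ _≃_

  _▷_ : Carrier → List Carrier → List Carrier
  x ▷ []       = []
  x ▷ (y ∷ ys) = (x ⇒ y) ∷ ((y ⇒ x) ▷ ys)

  _⇛_ : List Carrier → List Carrier → List Carrier
  []       ⇛ ys = ys
  (x ∷ xs) ⇛ ys = xs ⇛ (x ▷ ys)

  ▷-cong : ∀ {x y xs ys} → x ≈ y → xs ≋ ys → x ▷ xs ≋ y ▷ ys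
  ▷-cong x≈y []            = []
  ▷-cong x≈y (z≈w ∷ zs≋ws) = ⇒-cong x≈y z≈w ∷ ▷-cong (⇒-cong z≈w x≈y) zs≋ws

  ⇛-cong : ∀ {xs ys zs ws} → xs ≋ ys → zs ≋ ws → xs ⇛ zs ≋ ys ⇛ ws
  ⇛-cong []            zs≋ws = zs≋ws
  ⇛-cong (x≈y ∷ xs≋ys) zs≋ws = ⇛-cong xs≋ys (▷-cong x≈y zs≋ws)

  ⇛-congˡ : ∀ xs {ys zs} → ys ≋ zs → xs ⇛ ys ≋ xs ⇛ zs
  ⇛-congˡ xs = ⇛-cong (≋-refl {xs})

  ⇛-[] : ∀ xs → xs ⇛ [] ≡ []
  ⇛-[] []       = ≡.refl
  ⇛-[] (x ∷ xs) = ⇛-[] xs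

  ++-⇛ : ∀ xs ys zs → (xs ++ ys) ⇛ zs ≡ ys ⇛ (xs ⇛ zs)
  ++-⇛ []       ys zs = ≡.refl
  ++-⇛ (x ∷ xs) ys zs = ++-⇛ xs ys (x ▷ zs)

  -- The product law for a list as premise: `y ▷ xs` is what remains of `xs` after `y`. This law and
  -- its generalizations `▷-++` and `⇛-++` are identities of lists and use no equation of `A`.
  ⇛-∷ : ∀ xs y ys → xs ⇛ (y ∷ ys) ≡ (xs ⇛ [ y ]) ++ ((y ▷ xs) ⇛ ys)
  ⇛-∷ []       y ys = ≡.refl
  ⇛-∷ (x ∷ xs) y ys = ⇛-∷ xs (x ⇒ y) ((y ⇒ x) ▷ ys)

  ▷-++ : ∀ x ys zs → x ▷ (ys ++ zs) ≡ (x ▷ ys) ++ ((ys ⇛ [ x ]) ⇛ zs)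
  ▷-++ x []       zs = ≡.refl
  ▷-++ x (y ∷ ys) zs = ≡.cong ((x ⇒ y) ∷_) (▷-++ (y ⇒ x) ys zs)

  ⇛-++ : ∀ xs ys zs → xs ⇛ (ys ++ zs) ≡ (xs ⇛ ys) ++ ((ys ⇛ xs) ⇛ zs)
  ⇛-++ [] ys zs = ≡.cong (ys ++_) (≡.cong (_⇛ zs) (≡.sym (⇛-[] ys)))
  ⇛-++ (x ∷ xs) ys zs = ≡R.begin
    xs ⇛ (x ▷ (ys ++ zs))
      ≡R.≡⟨ ≡.cong (xs ⇛_) (▷-++ x ys zs) ⟩
    xs ⇛ ((x ▷ ys) ++ ((ys ⇛ [ x ]) ⇛ zs))
      ≡R.≡⟨ ⇛-++ xs (x ▷ ys) ((ys ⇛ [ x ]) ⇛ zs) ⟩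
    (xs ⇛ (x ▷ ys)) ++ (((x ▷ ys) ⇛ xs) ⇛ ((ys ⇛ [ x ]) ⇛ zs))
      ≡R.≡⟨ ≡.cong ((xs ⇛ (x ▷ ys)) ++_) (++-⇛ (ys ⇛ [ x ]) ((x ▷ ys) ⇛ xs) zs) ⟨
    (xs ⇛ (x ▷ ys)) ++ (((ys ⇛ [ x ]) ++ ((x ▷ ys) ⇛ xs)) ⇛ zs)
      ≡R.≡⟨ ≡.cong (λ ws → (xs ⇛ (x ▷ ys)) ++ (ws ⇛ zs)) (⇛-∷ ys x xs) ⟨
    (xs ⇛ (x ▷ ys)) ++ ((ys ⇛ (x ∷ xs)) ⇛ zs)
      ≡R.∎
    where module ≡R = ≡.≡-Reasoning

  -- Both sides are the residual of `z` by the meet of `x` and `y`.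
  ⇒-cycle : ∀ x y z → (x ⇒ y) ⇒ (x ⇒ z) ≈ (y ⇒ x) ⇒ (y ⇒ z)
  ⇒-cycle x y z = trans (⇒-swap (x ⇒ y) x z) (trans (⇒-curry x (x ⇒ y) z)
    (trans (⇒-congʳ (divisibility x y)) (trans (sym (⇒-curry y (y ⇒ x) z))
      (⇒-swap y (y ⇒ x) z))))

  ▷-cycle : ∀ x y zs → (x ⇒ y) ▷ (x ▷ zs) ≋ (y ⇒ x) ▷ (y ▷ zs)
  ▷-cycle x y []       = []
  ▷-cycle x y (z ∷ zs) = ⇒-cycle x y z ∷ (begin
    -- Rotating through `z` makes the premise a residual of `z ⇒ y` by `z ⇒ x`, which fits the
    -- induction hypothesis.
    ((x ⇒ z) ⇒ (x ⇒ y)) ▷ ((z ⇒ x) ▷ zs)  ≈⟨ ▷-cong (⇒-cycle x z y) ≋-refl ⟩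
    ((z ⇒ x) ⇒ (z ⇒ y)) ▷ ((z ⇒ x) ▷ zs)  ≈⟨ ▷-cycle (z ⇒ x) (z ⇒ y) zs ⟩
    ((z ⇒ y) ⇒ (z ⇒ x)) ▷ ((z ⇒ y) ▷ zs)  ≈⟨ ▷-cong (⇒-cycle z y x) ≋-refl ⟩
    ((y ⇒ z) ⇒ (y ⇒ x)) ▷ ((z ⇒ y) ▷ zs)  ∎)

  ▷-⇛-cycle : ∀ x ys zs → (x ▷ ys) ⇛ (x ▷ zs) ≋ (ys ⇛ [ x ]) ⇛ (ys ⇛ zs)
  ▷-⇛-cycle x []       zs = ≋-refl
  ▷-⇛-cycle x (y ∷ ys) zs = begin
    ((y ⇒ x) ▷ ys) ⇛ ((x ⇒ y) ▷ (x ▷ zs))    ≈⟨ ⇛-congˡ ((y ⇒ x) ▷ ys) (▷-cycle x y zs) ⟩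
    ((y ⇒ x) ▷ ys) ⇛ ((y ⇒ x) ▷ (y ▷ zs))    ≈⟨ ▷-⇛-cycle (y ⇒ x) ys (y ▷ zs) ⟩
    (ys ⇛ [ y ⇒ x ]) ⇛ (ys ⇛ (y ▷ zs))       ∎

  -- This law yields divisibility, transitivity of `≲` and compatibility of `⇛` with `≃`.
  ⇛-cycle : ∀ xs ys zs → (xs ⇛ ys) ⇛ (xs ⇛ zs) ≋ (ys ⇛ xs) ⇛ (ys ⇛ zs)
  ⇛-cycle [] ys zs = ⇛-cong (≋-sym (≋-reflexive (⇛-[] ys))) ≋-refl
  ⇛-cycle (x ∷ xs) ys zs = begin
    (xs ⇛ (x ▷ ys)) ⇛ (xs ⇛ (x ▷ zs))                ≈⟨ ⇛-cycle xs (x ▷ ys) (x ▷ zs) ⟩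
    ((x ▷ ys) ⇛ xs) ⇛ ((x ▷ ys) ⇛ (x ▷ zs))          ≈⟨ ⇛-congˡ ((x ▷ ys) ⇛ xs) (▷-⇛-cycle x ys zs) ⟩
    ((x ▷ ys) ⇛ xs) ⇛ ((ys ⇛ [ x ]) ⇛ (ys ⇛ zs))     ≡⟨ ++-⇛ (ys ⇛ [ x ]) ((x ▷ ys) ⇛ xs) (ys ⇛ zs) ⟨
    ((ys ⇛ [ x ]) ++ ((x ▷ ys) ⇛ xs)) ⇛ (ys ⇛ zs)    ≡⟨ ≡.cong (_⇛ (ys ⇛ zs)) (⇛-∷ ys x xs) ⟨
    (ys ⇛ (x ∷ xs)) ⇛ (ys ⇛ zs)                      ∎

  -- `All (_≈ ⊤)` would live in the level c ⊔ ℓ instead of ℓ.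
  Top : List Carrier → Set ℓ
  Top []       = Lift ℓ Unit.⊤
  Top (x ∷ xs) = x ≈ ⊤ × Top xs

  Top-resp-≋ : ∀ {xs ys} → xs ≋ ys → Top xs → Top ys
  Top-resp-≋ []              _            = lift Unit.tt
  Top-resp-≋ (x≈y ∷ xs≋ys) (x≈⊤ , xs≈⊤) = trans (sym x≈y) x≈⊤ , Top-resp-≋ xs≋ys xs≈⊤

  Top-++ : ∀ xs {ys} → Top xs → Top ys → Top (xs ++ ys)
  Top-++ []       _            ys≈⊤ = ys≈⊤
  Top-++ (x ∷ xs) (x≈⊤ , xs≈⊤) ys≈⊤ = x≈⊤ , Top-++ xs xs≈⊤ ys≈⊤

  ▷-Top : ∀ x ys → Top ys → Top (x ▷ ys)
  ▷-Top x []       _            = lift Unit.tt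
  ▷-Top x (y ∷ ys) (y≈⊤ , ys≈⊤) =
    trans (⇒-congˡ y≈⊤) (⇒-zeroʳ x) , ▷-Top (y ⇒ x) ys ys≈⊤

  ⇛-Top : ∀ xs ys → Top ys → Top (xs ⇛ ys)
  ⇛-Top []       ys ys≈⊤ = ys≈⊤
  ⇛-Top (x ∷ xs) ys ys≈⊤ = ⇛-Top xs (x ▷ ys) (▷-Top x ys ys≈⊤)

  ⊤-▷ : ∀ {x} → x ≈ ⊤ → ∀ ys → x ▷ ys ≋ ys
  ⊤-▷ x≈⊤ []       = []
  ⊤-▷ x≈⊤ (y ∷ ys) = trans (⇒-congʳ x≈⊤) (⇒-identityˡ y)
    ∷ ⊤-▷ (trans (⇒-congˡ x≈⊤) (⇒-zeroʳ y)) ys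

  Top-⇛ : ∀ xs → Top xs → ∀ ys → xs ⇛ ys ≋ ys
  Top-⇛ []       _            ys = ≋-refl
  Top-⇛ (x ∷ xs) (x≈⊤ , xs≈⊤) ys = ≋-trans (Top-⇛ xs xs≈⊤ (x ▷ ys)) (⊤-▷ x≈⊤ ys)

  _≲_ : List Carrier → List Carrier → Set ℓ
  xs ≲ ys = Top (xs ⇛ ys)

  record _≃_ (xs ys : List Carrier) : Set ℓ where
    constructor _,_
    field
      ≃⇒≲ : xs ≲ ys
      ≃⇒≳ : ys ≲ xs

  ≲-refl : ∀ xs → xs ≲ xs
  ≲-refl []       = lift Unit.tt
  -- The new head `x ⇒ x` is `⊤`, and residuation by it leaves `xs` unchanged, so the tail is the
  -- induction hypothesis.
  ≲-refl (x ∷ xs) = ≡.subst Top (≡.sym (⇛-∷ xs (x ⇒ x) ((x ⇒ x) ▷ xs)))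
    (Top-++ (xs ⇛ [ x ⇒ x ]) (⇛-Top xs [ x ⇒ x ] (⇒-refl x , lift Unit.tt))
      (Top-resp-≋ (⇛-cong (≋-sym (⊤-▷ (⇒-refl x) xs)) (≋-sym (⊤-▷ (⇒-refl x) xs)))
        (≲-refl xs)))

  ≋⇒≲ : ∀ {xs ys} → xs ≋ ys → xs ≲ ys
  ≋⇒≲ {xs} xs≋ys = Top-resp-≋ (⇛-congˡ xs xs≋ys) (≲-refl xs)

  ≋⇒≃ : ∀ {xs ys} → xs ≋ ys → xs ≃ ys
  ≋⇒≃ xs≋ys = ≋⇒≲ xs≋ys , ≋⇒≲ (≋-sym xs≋ys)

  ≲-trans : ∀ xs ys zs → xs ≲ ys → ys ≲ zs → xs ≲ zs
  ≲-trans xs ys zs xs≲ys ys≲zs =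
    Top-resp-≋ (≋-trans (≋-sym (⇛-cycle xs ys zs)) (Top-⇛ (xs ⇛ ys) xs≲ys (xs ⇛ zs)))
      (⇛-Top (ys ⇛ xs) (ys ⇛ zs) ys≲zs)

  -- The two ends of the cycle law have trivial outer premises. The conclusion is even entrywise
  -- equality.
  ≃-⇛ : ∀ xs ys → xs ≃ ys → ∀ zs → xs ⇛ zs ≋ ys ⇛ zs
  ≃-⇛ xs ys (xs≲ys , ys≲xs) zs = begin
    xs ⇛ zs                ≈⟨ Top-⇛ (xs ⇛ ys) xs≲ys (xs ⇛ zs) ⟨
    (xs ⇛ ys) ⇛ (xs ⇛ zs)  ≈⟨ ⇛-cycle xs ys zs ⟩
    (ys ⇛ xs) ⇛ (ys ⇛ zs)  ≈⟨ Top-⇛ (ys ⇛ xs) ys≲xs (ys ⇛ zs) ⟩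
    ys ⇛ zs                ∎

  -- A Yoneda argument, with `ys` and `xs` as test lists; equations between products are then proved
  -- by comparing residuals.
  ⇛-≃ : ∀ xs ys → (∀ zs → xs ⇛ zs ≋ ys ⇛ zs) → xs ≃ ys
  ⇛-≃ xs ys eq = Top-resp-≋ (≋-sym (eq ys)) (≲-refl ys) , Top-resp-≋ (eq xs) (≲-refl xs)

  ⇛-mono : ∀ xs ys zs → ys ≲ zs → (xs ⇛ ys) ≲ (xs ⇛ zs)
  ⇛-mono xs ys zs ys≲zs =
    Top-resp-≋ (≋-sym (⇛-cycle xs ys zs)) (⇛-Top (ys ⇛ xs) (ys ⇛ zs) ys≲zs)

  -- The residual has the entries `y ⇒ (x ⇒ y)` and `((x ⇒ y) ⇒ y) ⇒ ((y ⇒ x) ⇒ x)`. The second is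
  -- `⊤` by the Wajsberg identity, and commutativity of `++` rests on this.
  pair-comm : ∀ x y → (x ∷ [ y ]) ≲ (y ∷ [ x ])
  pair-comm x y =
    trans (⇒-swap y x y) (trans (⇒-congˡ (⇒-refl y)) (⇒-zeroʳ x))
    , ≤-reflexive (wajsberg x y)
    , lift Unit.tt

  ▷-swap : ∀ x y zs → x ▷ (y ▷ zs) ≋ y ▷ (x ▷ zs)
  ▷-swap x y = ≃-⇛ (y ∷ [ x ]) (x ∷ [ y ]) (pair-comm y x , pair-comm x y)

  ▷-⇛-swap : ∀ x ys zs → x ▷ (ys ⇛ zs) ≋ ys ⇛ (x ▷ zs)
  ▷-⇛-swap x []       zs = ≋-refl
  ▷-⇛-swap x (y ∷ ys) zs =
    ≋-trans (▷-⇛-swap x ys (y ▷ zs)) (⇛-congˡ ys (▷-swap x y zs))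

  ⇛-swap : ∀ xs ys zs → xs ⇛ (ys ⇛ zs) ≋ ys ⇛ (xs ⇛ zs)
  ⇛-swap []       ys zs = ≋-refl
  ⇛-swap (x ∷ xs) ys zs =
    ≋-trans (⇛-congˡ xs (▷-⇛-swap x ys zs)) (⇛-swap xs ys (x ▷ zs))

  ⇛-curry : ∀ xs ys zs → xs ⇛ (ys ⇛ zs) ≋ (xs ++ ys) ⇛ zs
  ⇛-curry xs ys zs =
    ≋-trans (⇛-swap xs ys zs) (≋-reflexive (≡.sym (++-⇛ xs ys zs)))

  ++-comm : ∀ xs ys → xs ++ ys ≃ ys ++ xs
  ++-comm xs ys = ⇛-≃ (xs ++ ys) (ys ++ xs) λ zs → begin
    (xs ++ ys) ⇛ zs  ≈⟨ ⇛-curry xs ys zs ⟨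
    xs ⇛ (ys ⇛ zs)   ≡⟨ ++-⇛ ys xs zs ⟨
    (ys ++ xs) ⇛ zs  ∎

  ++-cong : ∀ xs ys zs ws → xs ≃ ys → zs ≃ ws → xs ++ zs ≃ ys ++ ws
  ++-cong xs ys zs ws xs≃ys zs≃ws = ⇛-≃ (xs ++ zs) (ys ++ ws) λ vs → begin
    (xs ++ zs) ⇛ vs  ≡⟨ ++-⇛ xs zs vs ⟩
    zs ⇛ (xs ⇛ vs)   ≈⟨ ⇛-congˡ zs (≃-⇛ xs ys xs≃ys vs) ⟩
    zs ⇛ (ys ⇛ vs)   ≈⟨ ≃-⇛ zs ws zs≃ws (ys ⇛ vs) ⟩
    ws ⇛ (ys ⇛ vs)   ≡⟨ ++-⇛ ys ws vs ⟨
    (ys ++ ws) ⇛ vs  ∎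

  ≃-trans : ∀ xs ys zs → xs ≃ ys → ys ≃ zs → xs ≃ zs
  ≃-trans xs ys zs (xs≲ys , ys≲xs) (ys≲zs , zs≲ys) =
    ≲-trans xs ys zs xs≲ys ys≲zs , ≲-trans zs ys xs zs≲ys ys≲xs

  ⇛-cong-≃ : ∀ xs ys zs ws → xs ≃ ys → zs ≃ ws → xs ⇛ zs ≃ ys ⇛ ws
  ⇛-cong-≃ xs ys zs ws xs≃ys (zs≲ws , ws≲zs) =
    ≃-trans (xs ⇛ zs) (ys ⇛ zs) (ys ⇛ ws) (≋⇒≃ (≃-⇛ xs ys xs≃ys zs))
      (⇛-mono ys zs ws zs≲ws , ⇛-mono ys ws zs ws≲zs)

  Top⇒≃[] : ∀ xs → Top xs → xs ≃ []
  Top⇒≃[] xs xs≈⊤ = ⇛-Top xs [] (lift Unit.tt) , xs≈⊤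

  envelope : Hoop c ℓ
  envelope = record
    { Carrier = List Carrier
    ; _≈_     = _≃_
    ; _∙_     = _++_
    ; _⇒_     = _⇛_
    ; ⊤       = []
    ; isHoop  = record
      { isCommutativeMonoid = record
        { isMonoid = record
          { isSemigroup = record
            { isMagma = record
              { isEquivalence = record
                { refl  = λ {xs} → ≲-refl xs , ≲-refl xs
                ; sym   = λ (xs≲ys , ys≲xs) → ys≲xs , xs≲ys
                ; trans = λ {xs} {ys} {zs} → ≃-trans xs ys zs
                }
              ; ∙-cong = λ {xs} {ys} {zs} {ws} → ++-cong xs ys zs ws
              }
            ; assoc = λ xs ys zs → ≋⇒≃ (≋-reflexive (++-assoc xs ys zs))
            }
          ; identity = (λ xs → ≋⇒≃ ≋-refl) , (λ xs → ≋⇒≃ (≋-reflexive (++-identityʳ xs)))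
          }
        ; comm = ++-comm
        }
      ; ⇒-cong       = λ {xs} {ys} {zs} {ws} → ⇛-cong-≃ xs ys zs ws
      ; ⇒-refl       = λ xs → Top⇒≃[] (xs ⇛ xs) (≲-refl xs)
      ; divisibility = λ xs ys → ⇛-≃ (xs ++ (xs ⇛ ys)) (ys ++ (ys ⇛ xs)) λ zs → begin
          (xs ++ (xs ⇛ ys)) ⇛ zs  ≡⟨ ++-⇛ xs (xs ⇛ ys) zs ⟩
          (xs ⇛ ys) ⇛ (xs ⇛ zs)   ≈⟨ ⇛-cycle xs ys zs ⟩
          (ys ⇛ xs) ⇛ (ys ⇛ zs)   ≡⟨ ++-⇛ ys (ys ⇛ xs) zs ⟨
          (ys ++ (ys ⇛ xs)) ⇛ zs  ∎
      ; ⇒-curry      = λ xs ys zs → ≋⇒≃ (⇛-curry xs ys zs)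
      }
    }

  -- By the product law `xs ⇛ (xs ++ zs)` is `xs ⇛ xs` followed by the residual of `zs` by it, and
  -- all entries of `xs ⇛ xs` are `⊤`.
  envelope-cancellative : Cancellative envelope
  envelope-cancellative xs ys zs = E.trans
    (E.reflexive (++-⇛ xs ys (xs ++ zs)))
    (E.⇒-cong {ys} E.refl (E.trans
      (E.reflexive (⇛-++ xs xs zs))
      (E.∙-cong (E.⇒-refl xs) (≋⇒≃ (Top-⇛ (xs ⇛ xs) (≲-refl xs) zs)))))
    where module E = Hoop envelope

  []-injective : ∀ {x y} → [ x ] ≃ [ y ] → x ≈ y
  []-injective ((x≤y , _) , (y≤x , _)) = ≤-antisym x≤y y≤x

  []-⊤ : [ ⊤ ] ≃ []
  []-⊤ = Top⇒≃[] [ ⊤ ] (refl , lift Unit.tt)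

  []-cong : ∀ {x y} → x ≈ y → [ x ] ≃ [ y ]
  []-cong x≈y = ≋⇒≃ (x≈y ∷ [])

  -- In general the product x ∷ [ y ] lies strictly below [ x ∙ y ].
  []-∙-⇒ : ∀ x y z → (x ∷ [ y ]) ⇛ [ z ] ≃ [ x ∙ y ⇒ z ]
  []-∙-⇒ x y z = []-cong (trans (⇒-swap y x z) (⇒-curry x y z))

-- Embedding an interval of the hoop into an interval of its envelope.

module Embedding {c ℓ} (A : Hoop c ℓ) (wajsberg : WH A) (z : Hoop.Carrier A) (k : ℕ) where
  open Envelope A wajsberg
  module A  = Hoop A
  module AP = HoopProperties A
  module S  = Hoop envelope
  module SP = HoopProperties envelope
  module SC = CancellativeProperties envelope envelope-cancellative
  open A using (Carrier; _∙_; _⇒_)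
  open SP using (_⊛_; ×-congʳ; ×-distrib-+)
  open SetoidReasoning S.setoid

  n : ℕ
  -- A positive exponent lets `φ-injective` split off a first factor of the power.
  n = suc k

  u : S.Carrier
  u = n ⊛ [ z ]

  module Az = Interval A wajsberg z
  module Su = Interval envelope SC.cancellative⇒wajsberg u

  φ : Carrier → S.Carrier
  φ x = n ⊛ [ x ]

  φ-injective : ∀ {x y} → φ x S.≈ φ y → x A.≈ y
  φ-injective {x} {y} eq = AP.≤-antisym (φ-≤ x y eq) (φ-≤ y x (S.sym eq))
    where
    φ-≤ : ∀ x y → φ x S.≈ φ y → x A.≤ y
    φ-≤ x y eq = []-injective (begin
      [ x ⇒ y ]            ≈⟨ SP.x∙y≈⊤⇒x≈⊤ (begin
        φ (x ⇒ y)            ≈⟨ SC.⊛-⇒ n [ x ] [ y ] ⟨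
        φ x S.⇒ φ y          ≈⟨ SP.≤-reflexive eq ⟩
        S.⊤                  ∎) ⟩
      S.⊤                  ≈⟨ []-⊤ ⟨
      [ A.⊤ ]              ∎)

  φ-¬ : ∀ x → Su.¬ φ x S.≈ φ (Az.¬ x)
  φ-¬ x = SC.⊛-⇒ n [ x ] [ z ]

  φ-injectiveᵤ : ∀ {x y} → φ x Su.≈ᵤ φ y → x Az.≈ᵤ y
  φ-injectiveᵤ {x} {y} eq = φ-injective (begin
    φ (Az.¬ x)  ≈⟨ φ-¬ x ⟨
    Su.¬ φ x    ≈⟨ eq ⟩
    Su.¬ φ y    ≈⟨ φ-¬ y ⟩
    φ (Az.¬ y)  ∎)

  -- The lists `x ∷ [ y ]` and `[ x ∙ y ]` have the same residual into the single entry `z`, so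
  -- passing to the interval erases their difference.
  φ-∙ : ∀ x y → φ x S.∙ φ y Su.≈ᵤ φ (x ∙ y)
  φ-∙ x y = begin
    Su.¬ (φ x S.∙ φ y)           ≈⟨ Su.¬-cong (×-distrib-+ [ x ] [ y ] n) ⟨
    n ⊛ (x ∷ [ y ]) S.⇒ φ z      ≈⟨ SC.⊛-⇒ n (x ∷ [ y ]) [ z ] ⟩
    n ⊛ ((x ∷ [ y ]) S.⇒ [ z ])  ≈⟨ ×-congʳ n ([]-∙-⇒ x y z) ⟩
    φ (Az.¬ (x ∙ y))             ≈⟨ φ-¬ (x ∙ y) ⟨
    Su.¬ φ (x ∙ y)               ∎

  φ-⊤ : φ A.⊤ Su.≈ᵤ S.⊤
  φ-⊤ = Su.¬-cong (S.trans (×-congʳ n []-⊤) (SP.⊛-⊤ n))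

  φ-⟦⟧ : ∀ t x → ⟦ t ⟧ Su.interval (φ x) Su.≈ᵤ φ (⟦ t ⟧ Az.interval x)
  φ-⟦⟧ var     x = S.refl
  φ-⟦⟧ (s · t) x = begin
    Su.¬ (sᵤ S.∙ tᵤ)      ≈⟨ Su.∙-congᵤ sᵤ (φ s₀) tᵤ (φ t₀) (φ-⟦⟧ s x) (φ-⟦⟧ t x) ⟩
    Su.¬ (φ s₀ S.∙ φ t₀)  ≈⟨ φ-∙ s₀ t₀ ⟩
    Su.¬ φ (s₀ ∙ t₀)      ∎
    where
    sᵤ = ⟦ s ⟧ Su.interval (φ x)
    tᵤ = ⟦ t ⟧ Su.interval (φ x)
    s₀ = ⟦ s ⟧ Az.interval x
    t₀ = ⟦ t ⟧ Az.interval x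
  φ-⟦⟧ (s ⟶ t) x = Su.¬-cong (begin
    Su.¬ (sᵤ S.∙ Su.¬ tᵤ)        ≈⟨ Su.∙-congᵤ sᵤ (φ s₀) (Su.¬ tᵤ) (φ (Az.¬ t₀)) (φ-⟦⟧ s x)
                                      (Su.¬-cong (S.trans (φ-⟦⟧ t x) (φ-¬ t₀))) ⟩
    Su.¬ (φ s₀ S.∙ φ (Az.¬ t₀))  ≈⟨ φ-∙ s₀ (Az.¬ t₀) ⟩
    Su.¬ φ (s₀ ∙ Az.¬ t₀)        ≈⟨ φ-¬ (s₀ ∙ Az.¬ t₀) ⟩
    φ (s₀ Az.⇒ᵤ t₀)              ∎)
    where
    sᵤ = ⟦ s ⟧ Su.interval (φ x)
    tᵤ = ⟦ t ⟧ Su.interval (φ x)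
    s₀ = ⟦ s ⟧ Az.interval x
    t₀ = ⟦ t ⟧ Az.interval x
  φ-⟦⟧ ⊤′      x = S.sym φ-⊤

-- Term conuclei on Wajsberg hoops are the identity.

module _ {c ℓ} (t : Term) (conucleus : t IsConucleusOn WH {c} {ℓ})
  (A : Hoop c ℓ) (wajsberg : WH A) (a : Hoop.Carrier A) where
  open Hoop A
  open HoopProperties A
  open Envelope A wajsberg
  -- With n = `occ t` + 1, both z = aⁿ in `A` and u = zⁿ in the envelope use this exponent; the
  -- extra factor makes z lie below `a` as well as below its power `occ t`.
  open Embedding A wajsberg (suc (occ t) ⊛ a) (occ t)

  -- Both sides lie above z, so they may be compared in the interval over z and then, by injectivity
  -- of `φ`, in the one over `u`.
  ⟦⟧≈x-if-deg≡1 : deg t ≡ 1 → ⟦ t ⟧ A a ≈ a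
  ⟦⟧≈x-if-deg≡1 deg≡1 = Az.≈ᵤ⇒≈ (≤-trans z≤occ (occ-≤ t a)) z≤a
    (trans (sym (Az.⟦⟧-interval t a z≤occ))
      (φ-injectiveᵤ (S.trans (S.sym (φ-⟦⟧ t a)) fixes-φa)))
    where
    z≤a : suc (occ t) ⊛ a ≤ a
    z≤a = x∙y≤x a (occ t ⊛ a)

    z≤occ : suc (occ t) ⊛ a ≤ occ t ⊛ a
    z≤occ = x∙y≤y a (occ t ⊛ a)

    u≤occ : u S.≤ occ t SP.⊛ [ a ]
    -- From z ≤ a follows u ≤ `φ a`, and `φ a` is `[ a ]` times its power `occ t`.
    u≤occ = SP.≤-trans {u} {φ a} {occ t SP.⊛ [ a ]}
      (SP.⊛-mono n {[ suc (occ t) ⊛ a ]} {[ a ]} (Top⇒≃[] [ _ ] (z≤a , lift Unit.tt)))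
      (SP.x∙y≤y [ a ] (occ t SP.⊛ [ a ]))

    fixes-[a] : ⟦ t ⟧ Su.interval [ a ] Su.≈ᵤ [ a ]
    fixes-[a] = S.trans (Su.⟦⟧-interval t [ a ] u≤occ) (Su.¬-cong (begin
      ⟦ t ⟧ envelope [ a ]  ≈⟨ SC.⟦⟧≈deg⊛ t [ a ] ⟩
      deg t SP.⊛ [ a ]      ≡⟨ ≡.cong (SP._⊛ [ a ]) deg≡1 ⟩
      [ a ]                 ∎))
      where open SetoidReasoning S.setoid

    fixes-φa : ⟦ t ⟧ Su.interval (φ a) Su.≈ᵤ φ a
    fixes-φa = ≡.subst (λ x → ⟦ t ⟧ Su.interval x Su.≈ᵤ x) (Su.⊛-interval n [ a ])
      (HoopProperties.⟦⟧-fixes-⊛ Su.interval t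
        (conucleus Su.interval Su.interval-wajsberg) fixes-[a] n)

  conucleus⇒⟦⟧≈x : ⟦ t ⟧ A a ≈ a
  conucleus⇒⟦⟧≈x with SC.conucleus-deg t (conucleus envelope SC.cancellative⇒wajsberg) [ a ]
  ... | inj₁ deg≡1 = ⟦⟧≈x-if-deg≡1 deg≡1
  ... | inj₂ [a]≈⊤ = trans (⟦⟧-cong t a≈⊤) (trans (⟦⟧-⊤ t) (sym a≈⊤))
    where
    a≈⊤ : a ≈ ⊤
    a≈⊤ = proj₁ (_≃_.≃⇒≳ [a]≈⊤)

proposition4p2 : (c ℓ : Level) (t : Term) → (t IsConucleusOn WH {c} {ℓ}) ⇔ (WH {c} {ℓ} ⊨ t ≈ var)
proposition4p2 c ℓ t = mk⇔ (conucleus⇒⟦⟧≈x t)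
  (λ t≈x A wajsberg → HoopProperties.id-isConucleus A (t≈x A wajsberg))
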